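{- For all integers $n\ge 1$, the set $L_B(n+1)$ of all partitions of $n+1$ is the disjoint union $$L_B(n+1)=L_B(n)^{\downarrow_1}\;\sqcup\; S(n)^{\downarrow_2}\;\sqcup\; NS(n)^{\downarrow_2}\;\sqcup\;\bigsqcup_{n>\ell\ge 1}P_\ell(n)^{\downarrow_{\ell+2}} .$$
   Context: A partition of $n$ is a sequence of integers $a=(a_1,\dots,a_k)$ with $a_1\ge a_2\ge\dots\ge a_k>0$ and $\sum_i a_i=n$; by convention $a_j=0$ for $j>k$. $L_B(n)$ is the set of all partitions of $n$. For a partition $a$ and an index $i$, $a^{\downarrow_i}$ denotes the sequence obtained from $a$ by replacing $a_i$ by $a_i+1$ (adding one grain on the $i$-th column of its Ferrers diagram); for a set $S$ of partitions, $S^{\downarrow_i}=\{a^{\downarrow_i}: a\in S\}$. Let $d_i(a)=a_i-a_{i+1}$. The partition $a$ has a cliff at $i$ if $d_i(a)\ge 2$. It has a slippery plateau at $i$ if there is $m>i$ with $d_j(a)=0$ for all $i\le j<m$ and $d_m(a)=1$; the integer $m-i$ is the length of the slippery plateau. It has a non-slippery plateau at $i$ if there is $m>i$ with $d_j(a)=0$ for all $i\le j<m$ and $a$ has a cliff at $m$. It has a slippery step (resp. a non-slippery step) at $i$ if the sequence $a'=(a_1,\dots,a_{i-1},a_i-1,a_{i+1},\dots,a_k)$ is a partition with a slippery plateau (resp. a non-slippery plateau) at $i$. $S(n)$, $NS(n)$ and $P_\ell(n)$ denote the sets of partitions of $n$ having, respectively, a slippery step at $1$, a non-slippery step at $1$,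 and a slippery plateau of length $\ell$ at $1$.
   Formalization: The decomposition as printed fails for n = 1, because the partition (1,1) of 2 lies in none of the pieces; the formal statement gives it for all n ≥ 2, and for n = 1 with L_B(2) replaced by L_B(2) minus {(1,1)}. -}

module Defs where

open import Data.Empty using (⊥-elim-irr)
open import Data.List using (List; []; _∷_; sum)
open import Data.List.Relation.Unary.All using (All; []; _∷_)
open import Data.List.Relation.Unary.Linked using (Linked; []; [-]; _∷_)
open import Data.Nat
open import Data.Product using (∃-syntax; _×_; _,_)
open import Level using (0ℓ)
open import Relation.Binary.PropositionalEquality using (_≡_; _≢_; refl)
open import Relation.Nullary using (¬_)
open import Relation.Unary using (Pred; _∈_; _⊥_; _≐_; ⋃)

-- Columns are numbered from 1.  Index 0 denotes no column: reading there
-- gives 0 and the two updates below do nothing.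

infixl 9 _‼_
_‼_ : List ℕ → ℕ → ℕ
a       ‼ zero        = 0
[]      ‼ suc i       = 0
(x ∷ a) ‼ 1           = x
(x ∷ a) ‼ suc (suc i) = a ‼ suc i

-- The sequence is extended by its conventional zeros when the column lies
-- beyond its end.

infixl 8 _↓_
_↓_ : List ℕ → ℕ → List ℕ
a       ↓ zero        = a
[]      ↓ 1           = 1 ∷ []
[]      ↓ suc (suc i) = 0 ∷ ([] ↓ suc i)
(x ∷ a) ↓ 1           = suc x ∷ a
(x ∷ a) ↓ suc (suc i) = x ∷ (a ↓ suc i)

-- A column of height 0 is left unchanged, and a column of height 1 leaves an
-- explicit 0 behind.  Neither affects the notion of step: if column i of a
-- partition has height 0, then there is no plateau at i.

removeGrain : List ℕ → ℕ → List ℕ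
removeGrain a       zero          = a
removeGrain []      (suc i)       = []
removeGrain (x ∷ a) 1             = pred x ∷ a
removeGrain (x ∷ a) (suc (suc i)) = x ∷ removeGrain a (suc i)

IsPartition : Pred (List ℕ) 0ℓ
IsPartition a = Linked _≥_ a × All (_> 0) a

L_B : ℕ → Pred (List ℕ) 0ℓ
L_B n a = IsPartition a × sum a ≡ n

-- Only used for partitions, where the subtraction does not truncate.

d : ℕ → List ℕ → ℕ
d i a = a ‼ i ∸ a ‼ suc i

Cliff : ℕ → Pred (List ℕ) 0ℓ
Cliff i a = d i a ≥ 2

FlatUntil : ℕ → ℕ → Pred (List ℕ) 0ℓ
FlatUntil i m a = ∀ j → i ≤ j → j < m → d j a ≡ 0

SlipperyPlateau : ℕ → Pred (List ℕ) 0ℓ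
SlipperyPlateau i a = ∃[ m ] (m > i × FlatUntil i m a × d m a ≡ 1)

SlipperyPlateauOfLength : ℕ → ℕ → Pred (List ℕ) 0ℓ
SlipperyPlateauOfLength ℓ i a =
  ∃[ m ] (m > i × FlatUntil i m a × d m a ≡ 1 × m ∸ i ≡ ℓ)

NonSlipperyPlateau : ℕ → Pred (List ℕ) 0ℓ
NonSlipperyPlateau i a = ∃[ m ] (m > i × FlatUntil i m a × Cliff m a)

SlipperyStep : ℕ → Pred (List ℕ) 0ℓ
SlipperyStep i a =
  IsPartition (removeGrain a i) × SlipperyPlateau i (removeGrain a i)

NonSlipperyStep : ℕ → Pred (List ℕ) 0ℓ
NonSlipperyStep i a =
  IsPartition (removeGrain a i) × NonSlipperyPlateau i (removeGrain a i)

S : ℕ → Pred (List ℕ) 0ℓ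
S n a = a ∈ L_B n × SlipperyStep 1 a

NS : ℕ → Pred (List ℕ) 0ℓ
NS n a = a ∈ L_B n × NonSlipperyStep 1 a

P : ℕ → ℕ → Pred (List ℕ) 0ℓ
P ℓ n a = a ∈ L_B n × SlipperyPlateauOfLength ℓ 1 a

infixl 8 _⇓_
_⇓_ : Pred (List ℕ) 0ℓ → ℕ → Pred (List ℕ) 0ℓ
(X ⇓ i) b = ∃[ a ] (a ∈ X × b ≡ a ↓ i)

infix 4 _IsDisjointUnionOf_
_IsDisjointUnionOf_ : {A I : Set} → Pred A 0ℓ → (I → Pred A 0ℓ) → Set
_IsDisjointUnionOf_ {I = I} X F =
  X ≐ ⋃ I F × (∀ i j → i ≢ j → F i ⊥ F j)

-- The bounds on ℓ are irrelevant, so that two indices of plateau pieces are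
-- distinct only when their lengths are.

data Index (n : ℕ) : Set where
  all : Index n
  s   : Index n
  ns  : Index n
  p   : (ℓ : ℕ) → .(n > ℓ) → .(ℓ ≥ 1) → Index n

piece : (n : ℕ) → Index n → Pred (List ℕ) 0ℓ
piece n all       = L_B n ⇓ 1
piece n s         = S n ⇓ 2
piece n ns        = NS n ⇓ 2
piece n (p ℓ _ _) = P ℓ n ⇓ (ℓ + 2)

-- The decomposition of L_B (suc n) into these pieces fails for n = 1: the
-- partition (1,1) is in none of them, because removing the grain of (1) leaves
-- every column empty, so that (1) has neither kind of step at 1.

¬L_B2-decomposition : ¬ (L_B 2 IsDisjointUnionOf piece 1)
¬L_B2-decomposition ((L⊆ , _) , _) = uncovered (L⊆ {1 ∷ 1 ∷ []} 11∈L)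
  where
  11∈L : L_B 2 (1 ∷ 1 ∷ [])
  11∈L = (s≤s z≤n ∷ [-] , s≤s z≤n ∷ s≤s z≤n ∷ []) , refl

  uncovered : ¬ ⋃ (Index 1) (piece 1) (1 ∷ 1 ∷ [])
  uncovered (all , (.0 ∷ .1 ∷ []) , ((_ , () ∷ _) , _) , refl)
  uncovered (s  , (.1 ∷ .0 ∷ []) , (((_ , _ ∷ () ∷ _) , _) , _) , refl)
  uncovered (s  , (.1 ∷ []) , (_ , (_ , () ∷ _) , _) , refl)
  uncovered (ns , (.1 ∷ .0 ∷ []) , (((_ , _ ∷ () ∷ _) , _) , _) , refl)
  uncovered (ns , (.1 ∷ []) , (_ , (_ , () ∷ _) , _) , refl)
  uncovered (p zero _ () , _)
  uncovered (p (suc _) 1>ℓ _ , _) = ⊥-elim-irr (1≯1+n 1>ℓ)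
    where
    1≯1+n : ∀ {k} → ¬ (1 > suc k)
    1≯1+n (s≤s ())

{-# OPTIONS --safe #-}
module Submission where

-- Sort the partitions b of n + 1 by the first column m at which b drops.
-- If m = 1, a grain can be taken off column 1.  Otherwise b is flat up to
-- column m, and taking a grain off column m leaves a partition which drops by
-- exactly 1 at column m − 1: for m ≥ 3 it is a slippery plateau of length
-- m − 2, and for m = 2 it is a step, slippery or not according to the height
-- of the first drop behind it; the latter fails to exist only for b = (1,1).
-- Uniqueness of the first drop gives disjointness.

open import Defs
open import Data.Empty using (⊥-elim)
open import Data.List using (List; []; _∷_)
open import Data.List.Properties using (≡-dec)
open import Data.List.Relation.Unary.All using ([]; _∷_)
open import Data.List.Relation.Unary.Linked using ([]; [-]; _∷_)
open import Data.Nat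
open import Data.Nat.ListAction using (sum)
open import Data.Nat.Properties
open import Data.Product using (∃-syntax; _×_; _,_; proj₁; proj₂)
open import Relation.Binary.Definitions using (tri<; tri≈; tri>)
open import Relation.Binary.PropositionalEquality
open import Relation.Nullary using (¬_; yes; no)
open import Relation.Unary using (_∈_; _∖_; ｛_｝; _⊆_; _⊥_; ⋃)

-- Partitions and grains, entry by entry.

cons⁺ : ∀ {x a} → x > 0 → a ‼ 1 ≤ x → IsPartition a → IsPartition (x ∷ a)
cons⁺ {a = []}    x>0 _   _         = [-] , x>0 ∷ []
cons⁺ {a = _ ∷ _} x>0 y≤x (lk , al) = y≤x ∷ lk , x>0 ∷ al

cons⁻ : ∀ {x a} → IsPartition (x ∷ a) → x > 0 × a ‼ 1 ≤ x × IsPartition a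
cons⁻ {a = []}    (_ , x>0 ∷ _)         = x>0 , z≤n , [] , []
cons⁻ {a = _ ∷ _} (y≤x ∷ lk , x>0 ∷ al) = x>0 , y≤x , lk , al

sum-↓ : ∀ a i → sum (a ↓ suc i) ≡ suc (sum a)
sum-↓ []      zero    = refl
sum-↓ []      (suc i) = sum-↓ [] i
sum-↓ (x ∷ a) zero    = refl
sum-↓ (x ∷ a) (suc i) = trans (cong (x +_) (sum-↓ a i)) (+-suc x (sum a))

↓1-‼1 : ∀ a → (a ↓ 1) ‼ 1 ≡ suc (a ‼ 1)
↓1-‼1 []      = refl
↓1-‼1 (_ ∷ _) = refl

↓-‼1 : ∀ a i → (a ↓ suc (suc i)) ‼ 1 ≡ a ‼ 1
↓-‼1 []      _ = refl
↓-‼1 (_ ∷ _) _ = refl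

-- First drops.

-- The drop is at column suc m, counting from 1, and has height suc h.

infix 5 _▹_
record FirstDrop (m h : ℕ) (a : List ℕ) : Set where
  constructor _▹_
  field
    flat : FlatUntil 1 (suc m) a
    drop : d (suc m) a ≡ suc h

open FirstDrop

FirstDrop-here : ∀ {h a} → d 1 a ≡ suc h → FirstDrop 0 h a
FirstDrop-here eq = (λ j 1≤j j<1 → ⊥-elim (<⇒≱ j<1 1≤j)) ▹ eq

FirstDrop-cons : ∀ {x m h a} → d 1 (x ∷ a) ≡ 0 → FirstDrop m h a →
                 FirstDrop (suc m) h (x ∷ a)
FirstDrop-cons {x} {m} {a = a} flat₁ (f ▹ e) = flat′ ▹ e
  where
  flat′ : FlatUntil 1 (suc (suc m)) (x ∷ a)
  flat′ 1             _ _        = flat₁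
  flat′ (suc (suc j)) _ (s≤s lt) = f (suc j) (s≤s z≤n) lt

FirstDrop-uncons : ∀ {x m h a} → FirstDrop (suc m) h (x ∷ a) →
                   d 1 (x ∷ a) ≡ 0 × FirstDrop m h a
FirstDrop-uncons {m = m} {a = a} (f ▹ e) =
  f 1 ≤-refl (s≤s (s≤s z≤n)) , flat′ ▹ e
  where
  flat′ : FlatUntil 1 (suc m) a
  flat′ (suc j) _ lt = f (suc (suc j)) (s≤s z≤n) (s≤s lt)

FirstDrop-unique : ∀ {m m′ h h′ a} → FirstDrop m h a → FirstDrop m′ h′ a →
                   m ≡ m′ × h ≡ h′
FirstDrop-unique {m} {m′} (f ▹ e) (f′ ▹ e′) with <-cmp m m′
... | tri≈ _ refl _ = refl , suc-injective (trans (sym e) e′)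
... | tri< lt _ _ with () ← trans (sym e) (f′ (suc m) (s≤s z≤n) (s≤s lt))
... | tri> _ _ gt with () ← trans (sym e′) (f (suc m′) (s≤s z≤n) (s≤s gt))

firstDrop : ∀ {x a} → IsPartition (x ∷ a) → ∃[ m ] ∃[ h ] FirstDrop m h (x ∷ a)
firstDrop {zero}  {[]}    (_ , () ∷ _)
firstDrop {suc x} {[]}    _ = 0 , x , FirstDrop-here refl
firstDrop {x}     {y ∷ a} pa with x ∸ y in eq
... | suc h = 0 , h , FirstDrop-here eq
... | zero with m , h , fd ← firstDrop (proj₂ (proj₂ (cons⁻ pa))) =
  suc m , h , FirstDrop-cons eq fd

-- All `suc m` columns up to the drop are nonempty. This supplies the bound `n > ℓ` on plateau
-- lengths.
m<sum : ∀ {m h a} → IsPartition a → FirstDrop m h a → m < sum a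
m<sum {zero}  {a = []}    _  (_ ▹ ())
m<sum {suc m} {a = []}    _  (_ ▹ ())
m<sum {zero}  {a = x ∷ a} pa _  = ≤-trans (proj₁ (cons⁻ pa)) (m≤m+n x (sum a))
m<sum {suc m} {a = x ∷ a} pa fd with x>0 , _ , pa′ ← cons⁻ pa =
  +-mono-≤ x>0 (m<sum pa′ (proj₂ (FirstDrop-uncons fd)))

-- Adding and removing a grain at the first drop.

raise₁ : ∀ {a} → IsPartition a →
         IsPartition (a ↓ 1) × ∃[ h ] FirstDrop 0 h (a ↓ 1)
raise₁ {[]}    _  = ([-] , s≤s z≤n ∷ []) , 0 , FirstDrop-here refl
raise₁ {x ∷ a} pa with _ , y≤x , pa′ ← cons⁻ pa =
  cons⁺ (s≤s z≤n) (m≤n⇒m≤1+n y≤x) pa′ ,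
  x ∸ a ‼ 1 , FirstDrop-here (+-∸-assoc 1 y≤x)

-- The grain on the next column levels a drop of exactly 1, and that column, now raised, drops in
-- its turn.
raise : ∀ {m a} → IsPartition a → FirstDrop m 0 a →
        IsPartition (a ↓ suc (suc m)) ×
        ∃[ h ] FirstDrop (suc m) h (a ↓ suc (suc m))
raise {zero}  {[]} _ (_ ▹ ())
raise {suc m} {[]} _ (_ ▹ ())
raise {zero} {x ∷ a} pa (_ ▹ x∸y≡1)
  with x>0 , y≤x , pa′ ← cons⁻ pa
  with pa↓ , h , fd ← raise₁ pa′ =
  cons⁺ x>0 (≤-reflexive (sym x≡)) pa↓ ,
  h , FirstDrop-cons (m≤n⇒m∸n≡0 (≤-reflexive x≡)) fd
  where
  x≡ : x ≡ (a ↓ 1) ‼ 1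
  x≡ = trans (sym (m∸n+n≡m y≤x))
         (trans (cong (_+ a ‼ 1) x∸y≡1) (sym (↓1-‼1 a)))
raise {suc m} {x ∷ a} pa fd
  with x>0 , y≤x , pa′ ← cons⁻ pa
  with flat₁ , fd′ ← FirstDrop-uncons fd
  with pa↓ , h , fd↓ ← raise pa′ fd′ =
  cons⁺ x>0 (≤-trans (≤-reflexive (↓-‼1 a m)) y≤x) pa↓ ,
  h , FirstDrop-cons (trans (cong (x ∸_) (↓-‼1 a m)) flat₁) fd↓

lower₁ : ∀ {x b} → IsPartition (x ∷ b) → b ‼ 1 < x →
         ∃[ a ] (IsPartition a × a ↓ 1 ≡ x ∷ b)
-- The column disappears: a partition has no entry 0, so the preimage is `[]`, not `0 ∷ []`.
lower₁ {suc zero}    {[]}    _  _ = [] , ([] , []) , refl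
lower₁ {suc zero}    {_ ∷ _} (_ , _ ∷ s≤s _ ∷ _) (s≤s ())
lower₁ {suc (suc x)} {b}     pb (s≤s y≤x) =
  suc x ∷ b , cons⁺ (s≤s z≤n) y≤x (proj₂ (proj₂ (cons⁻ pb))) , refl

0<m∸n⇒n<m : ∀ {m n h} → m ∸ n ≡ suc h → n < m
0<m∸n⇒n<m eq = m∸n≢0⇒n<m λ eq0 → 0≢1+n (trans (sym eq0) eq)

flat-shape : ∀ {x b} → IsPartition (x ∷ b) → d 1 (x ∷ b) ≡ 0 →
             ∃[ r ] b ≡ x ∷ r
flat-shape {b = []}    (_ , s≤s _ ∷ _) ()
flat-shape {b = y ∷ r} pb flat₁
  with refl ← ≤-antisym (proj₁ (proj₂ (cons⁻ pb))) (m∸n≡0⇒m≤n flat₁) = r , refl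

-- Reverses `raise`: the column at the drop has a grain to spare, and taking it off opens a drop of
-- exactly 1 one column earlier, where the columns were level.
lower : ∀ {m h b} → IsPartition b → FirstDrop (suc m) h b →
        ∃[ a ] (IsPartition a × FirstDrop m 0 a × a ↓ suc (suc m) ≡ b)
lower {b = []} _ (_ ▹ ())
lower {zero} {b = x ∷ b} pb fd
  with flat₁ , fd′ ← FirstDrop-uncons fd
  with x>0 , _ , pb′ ← cons⁻ pb
  with r , refl ← flat-shape pb flat₁
  with a , pa , a↓≡ ← lower₁ pb′ (0<m∸n⇒n<m (drop fd′)) =
  x ∷ a , cons⁺ x>0 (≤-trans (n≤1+n _) (≤-reflexive (sym x≡))) pa ,
  FirstDrop-here (trans (cong (_∸ a ‼ 1) x≡) (m+n∸n≡m 1 (a ‼ 1))) ,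
  cong (x ∷_) a↓≡
  where
  x≡ : x ≡ suc (a ‼ 1)
  x≡ = trans (sym (cong (_‼ 1) a↓≡)) (↓1-‼1 a)
lower {suc m} {b = x ∷ b} pb fd
  with flat₁ , fd′ ← FirstDrop-uncons fd
  with x>0 , y≤x , pb′ ← cons⁻ pb
  with a , pa , fda , refl ← lower pb′ fd′ =
  x ∷ a , cons⁺ x>0 (≤-trans (≤-reflexive (sym (↓-‼1 a m))) y≤x) pa ,
  FirstDrop-cons (trans (cong (x ∸_) (sym (↓-‼1 a m))) flat₁) fda , refl

-- Plateaus and steps as first drops.

slippery⇒FirstDrop : ∀ a → SlipperyPlateau 1 a → ∃[ m ] FirstDrop (suc m) 0 a
slippery⇒FirstDrop a (suc (suc m) , _ , f , e) = m , f ▹ e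
slippery⇒FirstDrop a (suc zero , s≤s () , _)

nonSlippery⇒FirstDrop : ∀ a → NonSlipperyPlateau 1 a →
                        ∃[ m ] ∃[ h ] FirstDrop (suc m) (suc h) a
nonSlippery⇒FirstDrop a (suc (suc m) , _ , f , cliff) =
  -- The excess of the cliff over 2, which makes its height `suc (suc h)`.
  m , d (suc (suc m)) a ∸ 2 , f ▹ sym (m+[n∸m]≡n cliff)
nonSlippery⇒FirstDrop a (suc zero , s≤s () , _)

-- A flat start after the removal means that `a` itself drops by exactly 1 at column 1. Hence
-- `raise` applies to `a`, and `a ↓ 2` determines `y` and `r`, so also `a`.
step-shape : ∀ a {m h} → IsPartition (removeGrain a 1) →
             FirstDrop (suc m) h (removeGrain a 1) →
             ∃[ y ] ∃[ r ] a ≡ suc y ∷ y ∷ r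
step-shape []          _  (_ ▹ ())
step-shape (zero ∷ _)  (_ , () ∷ _) _
step-shape (suc x ∷ a) pa fd
  with r , refl ← flat-shape pa (proj₁ (FirstDrop-uncons fd)) = x , r , refl

-- By `step-shape`, equal results force `a` and `a′` to be equal; the first drop of
-- `removeGrain a 1` would then be both 1 and at least 2.
slipperyStep⊥nonSlipperyStep :
  ∀ a a′ → SlipperyStep 1 a → NonSlipperyStep 1 a′ → a ↓ 2 ≢ a′ ↓ 2
slipperyStep⊥nonSlipperyStep a a′ (pa , sp) (pa′ , np) eq
  with _ , fd ← slippery⇒FirstDrop (removeGrain a 1) sp
  with _ , _ , fd′ ← nonSlippery⇒FirstDrop (removeGrain a′ 1) np
  with _ , _ , refl ← step-shape a pa fd
  with _ , _ , refl ← step-shape a′ pa′ fd′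
  with refl ← eq
  with () ← proj₂ (FirstDrop-unique fd fd′)

-- Disjointness of the pieces.

-- The index `m` of the `FirstDrop` shared by all members of a piece. It separates any two pieces
-- except `s` and `ns`.
run : ∀ {n} → Index n → ℕ
run all       = 0
run s         = 1
run ns        = 1
run (p ℓ _ _) = suc ℓ

HasRun : ℕ → ℕ → List ℕ → Set
HasRun n m b = b ∈ L_B (suc n) × ∃[ h ] FirstDrop m h b

raise-HasRun : ∀ {n m a} → a ∈ L_B n → FirstDrop m 0 a →
               HasRun n (suc m) (a ↓ suc (suc m))
raise-HasRun {m = m} {a} (pa , refl) fd with pb , fdb ← raise pa fd =
  (pb , sum-↓ a (suc m)) , fdb

raise-step : ∀ {n} a {m h} → a ∈ L_B n → IsPartition (removeGrain a 1) →
             FirstDrop (suc m) h (removeGrain a 1) → HasRun n 1 (a ↓ 2)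
raise-step a a∈L pa fd with y , r , refl ← step-shape a pa fd =
  raise-HasRun a∈L (FirstDrop-here (m+n∸n≡m 1 y))

piece⇒HasRun : ∀ {n b} i → b ∈ piece n i → HasRun n (run i) b
piece⇒HasRun all (a , (pa , refl) , refl) with pb , fd ← raise₁ pa =
  (pb , sum-↓ a 0) , fd
piece⇒HasRun s (a , (a∈L , pa , sp) , refl) =
  raise-step a a∈L pa (proj₂ (slippery⇒FirstDrop (removeGrain a 1) sp))
piece⇒HasRun ns (a , (a∈L , pa , np) , refl) =
  raise-step a a∈L pa (proj₂ (proj₂ (nonSlippery⇒FirstDrop (removeGrain a 1) np)))
-- A plateau from column 1 to column `suc m` has length `m`, so its grain falls on column `m + 2`,
-- just behind the drop.
piece⇒HasRun (p ℓ _ _) (a , (a∈L , suc m , _ , f , e , refl) , refl)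
  rewrite +-comm m 2 = raise-HasRun a∈L (f ▹ e)

pieces-disjoint : ∀ {n} (i j : Index n) → i ≢ j → piece n i ⊥ piece n j
pieces-disjoint i j i≢j (b∈i , b∈j)
  with _ , _ , fd  ← piece⇒HasRun i b∈i
  with _ , _ , fd′ ← piece⇒HasRun j b∈j =
  sameRun i j i≢j b∈i b∈j (proj₁ (FirstDrop-unique fd fd′))
  where
  sameRun : ∀ {n b} (i j : Index n) → i ≢ j → b ∈ piece n i → b ∈ piece n j →
            run i ≢ run j
  sameRun all all i≢j _ _ _ = i≢j refl
  sameRun s   s   i≢j _ _ _ = i≢j refl
  sameRun ns  ns  i≢j _ _ _ = i≢j refl
  sameRun (p _ _ _) (p _ _ _) i≢j _ _ refl = i≢j refl
  sameRun s ns _ (a , (_ , st) , refl) (a′ , (_ , st′) , eq) _ =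
    slipperyStep⊥nonSlipperyStep a a′ st st′ eq
  sameRun ns s _ (a , (_ , st) , refl) (a′ , (_ , st′) , eq) _ =
    slipperyStep⊥nonSlipperyStep a′ a st′ st (sym eq)
  -- Equal runs would mean `ℓ = 0`, contrary to `ℓ ≥ 1`.
  sameRun s  (p _ _ ()) _ _ _ refl
  sameRun ns (p _ _ ()) _ _ _ refl
  sameRun (p _ _ ()) s  _ _ _ refl
  sameRun (p _ _ ()) ns _ _ _ refl

-- Covering by the pieces.

-- Lowering both leading columns leaves a flat start whose first drop, 1 or larger, selects `s` or
-- `ns`. Only from columns of height 1 does nothing remain, and then `b` is (1,1).
cover-step : ∀ {n y r} → let b : List ℕ; b = suc y ∷ suc y ∷ r in
             b ∈ L_B (suc n) → r ‼ 1 < suc y → b ≢ 1 ∷ 1 ∷ [] →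
             b ∈ ⋃ (Index n) (piece n)
cover-step {y = zero}  {[]}    _ _ ≢11 = ⊥-elim (≢11 refl)
cover-step {y = zero}  {_ ∷ _} ((_ , _ ∷ _ ∷ s≤s _ ∷ _) , _) (s≤s ())
cover-step {n} {suc y} {r} (pb , sum≡) (s≤s r≤y) _ = split (firstDrop pc)
  where
  -- `a` is the given partition less a grain on column 2, and `c` is `removeGrain a 1`.
  a c : List ℕ
  a = suc (suc y) ∷ suc y ∷ r
  c = suc y ∷ suc y ∷ r

  pr : IsPartition r
  pr = proj₂ (proj₂ (cons⁻ (proj₂ (proj₂ (cons⁻ pb)))))

  pc : IsPartition c
  pc = cons⁺ (s≤s z≤n) ≤-refl (cons⁺ (s≤s z≤n) r≤y pr)

  a∈L : a ∈ L_B n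
  a∈L = cons⁺ (s≤s z≤n) (n≤1+n (suc y)) (proj₂ (proj₂ (cons⁻ pc))) ,
        suc-injective (trans (sym (sum-↓ a 1)) sum≡)

  split : ∃[ m ] ∃[ h ] FirstDrop m h c →
          a ↓ 2 ∈ ⋃ (Index n) (piece n)
  split (zero , h , fd) with () ← trans (sym (n∸n≡0 y)) (drop fd)
  split (suc m , zero , f ▹ e) =
    s , a , (a∈L , pc , suc (suc m) , s≤s (s≤s z≤n) , f , e) , refl
  split (suc m , suc h , f ▹ e) =
    ns , a , (a∈L , pc , suc (suc m) , s≤s (s≤s z≤n) , f ,
      ≤-trans (s≤s (s≤s z≤n)) (≤-reflexive (sym e))) , refl

cover : ∀ {n b} → b ∈ L_B (suc n) → b ≢ 1 ∷ 1 ∷ [] →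
        b ∈ ⋃ (Index n) (piece n)
cover {b = []} (_ , ()) _
cover {n} {x ∷ b} (pb , sum≡) ≢11 with firstDrop pb
... | zero , _ , fd with a , pa , a↓≡ ← lower₁ pb (0<m∸n⇒n<m (drop fd)) =
  all , a ,
  (pa , suc-injective (trans (sym (sum-↓ a 0)) (trans (cong sum a↓≡) sum≡))) ,
  sym a↓≡
... | suc zero , _ , fd
  with flat₁ , fd′ ← FirstDrop-uncons fd
  with r , refl ← flat-shape pb flat₁
  with s≤s _ ← proj₁ (cons⁻ pb) =
  cover-step (pb , sum≡) (0<m∸n⇒n<m (drop fd′)) ≢11
... | suc (suc m) , _ , fd with a , pa , fda , a↓≡ ← lower pb fd =
  -- The first drop of `a` is at column `suc (suc m)`, so its plateau has length `suc m`.
  p (suc m) m<n (s≤s z≤n) , a ,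
  ((pa , suma) , suc (suc m) , s≤s (s≤s z≤n) , flat fda , drop fda , refl) ,
  trans (sym a↓≡) (cong (a ↓_) (+-comm 2 (suc m)))
  where
  suma : sum a ≡ n
  suma = suc-injective
    (trans (sym (sum-↓ a (suc (suc m)))) (trans (cong sum a↓≡) sum≡))

  m<n : n > suc m
  m<n = ≤-trans (m<sum pa fda) (≤-reflexive suma)

pieces⊆L_B : ∀ {n} → ⋃ (Index n) (piece n) ⊆ L_B (suc n)
pieces⊆L_B (i , b∈i) = proj₁ (piece⇒HasRun i b∈i)

-- Were (1,1) covered too, `cover` would complete the decomposition for `n = 1`, which is refuted.
11∉pieces : ¬ (1 ∷ 1 ∷ [] ∈ ⋃ (Index 1) (piece 1))
11∉pieces 11∈ = ¬L_B2-decomposition ((L⊆ , pieces⊆L_B) , pieces-disjoint)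
  where
  L⊆ : L_B 2 ⊆ ⋃ (Index 1) (piece 1)
  L⊆ {b} b∈L with ≡-dec _≟_ b (1 ∷ 1 ∷ [])
  ... | yes refl = 11∈
  ... | no  b≢11 = cover b∈L b≢11

theorem1 : (∀ (n : ℕ) → n ≥ 2 → L_B (suc n) IsDisjointUnionOf piece n)
    × ((L_B 2 ∖ ｛ 1 ∷ 1 ∷ [] ｝) IsDisjointUnionOf piece 1)
theorem1 =
  (λ n n≥2 →
    -- (1,1) has sum 2, so it lies in `L_B (suc n)` only for `n = 1`.
    ((λ b∈L → cover b∈L λ { refl → <-irrefl (suc-injective (proj₂ b∈L)) n≥2 }) ,
     pieces⊆L_B) , pieces-disjoint) ,
  ((λ (b∈L , b≢11) → cover b∈L λ b≡11 → b≢11 (sym b≡11)) ,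
   (λ b∈ → pieces⊆L_B b∈ , λ { refl → 11∉pieces b∈ })) , pieces-disjoint
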